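{- For every $\varepsilon>0$ there exists $n_0$ such that every $3$-uniform hypergraph $(V,H)$ with $n=|V|\ge n_0$ vertices ($V$ finite) in which no line is universal has at least $(2-\varepsilon)\log_2 n$ distinct lines. That is, the number $m$ of distinct lines satisfies $m\ge (2-o(1))\log_2 n$ as $n\to\infty$.
   Context: A $3$-uniform hypergraph is a pair $(V,H)$ where $H$ is a family of $3$-element subsets of $V$. For distinct vertices $u,v$, the line $\overline{uv}$ is defined as $\overline{uv}=\{u,v\}\cup\{p\in V:\{u,v,p\}\in H\}$; lines are counted as sets. A line is universal if it equals $V$. -}

module Defs where

open import Data.Nat using (ℕ)
open import Data.Bool using (Bool; true; _∨_)
open import Data.Bool.Properties using () renaming (_≟_ to _≟ᵇ_)
open import Data.Fin using (Fin)
open import Data.Fin.Properties using () renaming (_≟_ to _≟ᶠ_)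
open import Data.Fin.Subset using (Subset; ⁅_⁆; _∪_; ⊤; ∣_∣)
open import Data.Vec using (tabulate)
open import Data.Vec.Properties using (≡-dec)
open import Data.List using (List; length; deduplicate; concatMap; allFin; filter)
open import Relation.Nullary using (¬_; Dec)
open import Relation.Nullary.Decidable using (⌊_⌋; ¬?)
open import Relation.Binary.PropositionalEquality using (_≡_; _≢_)

record Hypergraph3 (n : ℕ) : Set where
  field
    edge     : Subset n → Bool
    uniform3 : ∀ e → edge e ≡ true → ∣ e ∣ ≡ 3
open Hypergraph3 public

line : ∀ {n} → Hypergraph3 n → Fin n → Fin n → Subset n
line G u v = tabulate λ p →
  ⌊ p ≟ᶠ u ⌋ ∨ ⌊ p ≟ᶠ v ⌋ ∨ edge G (⁅ u ⁆ ∪ ⁅ v ⁆ ∪ ⁅ p ⁆)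

Universal : ∀ {n} → Subset n → Set
Universal L = L ≡ ⊤

NoUniversalLine : ∀ {n} → Hypergraph3 n → Set
NoUniversalLine {n} G = ∀ (u v : Fin n) → u ≢ v → ¬ Universal (line G u v)

allLines : ∀ {n} → Hypergraph3 n → List (Subset n)
allLines {n} G =
  concatMap (λ u → Data.List.map (line G u) (filter (λ v → ¬? (u ≟ᶠ v)) (allFin n)))
            (allFin n)

numLines : ∀ {n} → Hypergraph3 n → ℕ
numLines G = length (deduplicate (≡-dec _≟ᵇ_) (allLines G))

{-# OPTIONS --safe #-}
module Submission where

-- Colour each pair of vertices by its line, and call two lines equivalent under a set W of vertices
-- when they meet W in the same subset.  Let D hold one line from each class.
--   (1) If x ≠ x′ and z lies off the line xx′, then the line xz misses x′, the line x′z misses x,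
--       and if all lines wx, wx′ with w ∈ W agree, then xz and x′z are equivalent.  Not both are
--       in D, so x is determined by its lines to W together with the lines outside D through x.
--   (2) A vertex y is determined by a majority bit for each class and by the lines on
--       which its incidence departs from the majority of the class.
-- Putting the bits of (1) off D and those of (2) on D, a pair (x , y) costs m bits in total, so that
-- n² ≤ (m+1)ᵏ (m+1)ᵈ 2ᵐ when |W| = k and no vertex departs on more than d lines.  Adding a vertex
-- departing on more than d lines to W lowers the sum over all lines of ⌊log₂ (class size)⌋ ≤ log₂ m
-- by more than d; hence some W has k (d+1) ≤ m log₂ m, and d ≈ m / (4q log₂ m) makes
-- the factor (m+1)ᵏ⁺ᵈ at most 2^(m/2q) for large m.

open import Defs
open import Data.Nat using (ℕ; zero; suc; _≤_; _<_; _≤?_; z≤n; s≤s; s≤s⁻¹; NonZero; >-nonZero;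
  _+_; _*_; _∸_; _^_; _/_; _%_; ⌊_/2⌋; ⌈_/2⌉)
open import Data.Nat.Properties
open import Data.Nat.DivMod using (m≡m%n+[m/n]*n; m%n<n; m/n*n≤m)
open import Data.Nat.Induction using (<-rec)
open import Data.Nat.ListAction using (sum)
open import Data.Nat.Logarithm
  using (⌊log₂_⌋; ⌊log₂⌋-mono-≤; ⌊log₂⌊n/2⌋⌋≡⌊log₂n⌋∸1; ⌊log₂[2*b]⌋≡1+⌊log₂b⌋; ⌊log₂[2^n]⌋≡n)
open import Data.Nat.Solver using (module +-*-Solver)
open import Data.Bool using (Bool; true; false; not; _∨_; if_then_else_)
open import Data.Bool.Properties using (¬-not; not-¬; ∨-assoc; ∨-comm) renaming (_≟_ to _≟ᵇ_)
open import Data.Fin using (Fin; zero; suc; combine; remQuot; funToFin; finToFun)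
open import Data.Fin.Properties
  using (combine-injective; combine-remQuot; finToFun-funToFin; injective⇒≤; any?; ¬∀⟶∃¬)
  renaming (_≟_ to _≟ᶠ_; suc-injective to Fin-suc-injective)
open import Data.Fin.Subset using (Subset; ⁅_⁆; _∪_)
open import Data.Fin.Subset.Properties using (∪-comm; ∪-assoc)
open import Data.List using (List; []; _∷_; length; map; filter; allFin; head; deduplicate)
  renaming (lookup to lookupˡ)
open import Data.List.Properties using (length-filter; filter-≐; length-tabulate)
open import Data.List.Membership.Propositional using (_∈_; lose)
open import Data.List.Membership.Propositional.Properties
  using (∈-filter⁺; ∈-filter⁻; ∈-allFin; ∈-concatMap⁺; ∈-map⁺; ∈-deduplicate⁺)
open import Data.List.Relation.Unary.Any using (here; index)
open import Data.List.Relation.Unary.Any.Properties using (lookup-index)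
open import Data.List.Relation.Unary.All as All using (All; []; _∷_; all?)
open import Data.Maybe using (fromMaybe)
open import Data.Product using (Σ; _×_; _,_; proj₁; proj₂; ∃; uncurry)
open import Data.Vec using (Vec; lookup)
open import Data.Vec.Properties using (lookup∘tabulate; lookup-replicate; tabulate-cong; tabulate∘lookup; ≡-dec)
open import Function using (_∘_; Injective)
open import Relation.Nullary using (¬_; yes; no; does; contradiction)
open import Relation.Nullary.Decidable using (⌊_⌋; ¬?; _×-dec_; dec-true; dec-false; decidable-stable; isYes≗does)
open import Relation.Unary using (Pred; Decidable)
open import Relation.Binary.PropositionalEquality
  using (_≡_; _≢_; _≗_; refl; sym; trans; cong; cong₂; subst; ≢-sym; module ≡-Reasoning)

-- Injective codes for functions and short lists

true≢false : true ≢ false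
true≢false ()

funToFin-injective : ∀ {m n} (f g : Fin m → Fin n) → funToFin f ≡ funToFin g → f ≗ g
funToFin-injective f g eq i = begin
  f i                      ≡⟨ finToFun-funToFin f i ⟨
  finToFun (funToFin f) i  ≡⟨ cong (λ k → finToFun k i) eq ⟩
  finToFun (funToFin g) i  ≡⟨ finToFun-funToFin g i ⟩
  g i                      ∎
  where open ≡-Reasoning

bit : Bool → Fin 2
bit false = zero
bit true  = suc zero

bit-injective : Injective _≡_ _≡_ bit
bit-injective {false} {false} _ = refl
bit-injective {true}  {true}  _ = refl

-- Entries are shifted by one so that `zero` can mark the positions past the end of the list.
padded : ∀ {m} → List (Fin m) → ∀ d → Fin d → Fin (suc m)
padded []       _ _       = zero
padded (x ∷ _)  _ zero    = suc x
padded (_ ∷ xs) _ (suc i) = padded xs _ i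

padded-injective : ∀ {m d} (xs ys : List (Fin m)) → length xs ≤ d → length ys ≤ d →
                   padded xs d ≗ padded ys d → xs ≡ ys
padded-injective []       []       _       _       _  = refl
padded-injective []       (_ ∷ _)  _       (s≤s _) eq with () ← eq zero
padded-injective (_ ∷ _)  []       (s≤s _) _       eq with () ← eq zero
padded-injective (_ ∷ xs) (_ ∷ ys) (s≤s p) (s≤s q) eq =
  cong₂ _∷_ (Fin-suc-injective (eq zero)) (padded-injective xs ys p q (eq ∘ suc))

-- Counting with filters, sums and logarithms

module _ {a p q} {A : Set a} {P : Pred A p} {Q : Pred A q}
         (P? : Decidable P) (Q? : Decidable Q) where

  length-filter-⊆ : (∀ {x} → P x → Q x) → ∀ xs →
                    length (filter P? xs) ≤ length (filter Q? xs)
  length-filter-⊆ P⊆Q []       = z≤n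
  length-filter-⊆ P⊆Q (x ∷ xs) with P? x | Q? x
  ... | yes _ | yes _ = s≤s (length-filter-⊆ P⊆Q xs)
  ... | yes u | no ¬v = contradiction (P⊆Q u) ¬v
  ... | no _  | yes _ = m≤n⇒m≤1+n (length-filter-⊆ P⊆Q xs)
  ... | no _  | no _  = length-filter-⊆ P⊆Q xs

  length-filter-disjoint : ∀ {r} {R : Pred A r} (R? : Decidable R) →
    (∀ {x} → P x → R x) → (∀ {x} → Q x → R x) → (∀ {x} → P x → ¬ Q x) → ∀ xs →
    length (filter P? xs) + length (filter Q? xs) ≤ length (filter R? xs)
  length-filter-disjoint R? P⊆R Q⊆R P∩Q []       = z≤n
  length-filter-disjoint R? P⊆R Q⊆R P∩Q (x ∷ xs)
    with ih ← length-filter-disjoint R? P⊆R Q⊆R P∩Q xs | P? x | Q? x | R? x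
  ... | yes u | yes v | _     = contradiction v (P∩Q u)
  ... | yes u | no _  | no ¬w = contradiction (P⊆R u) ¬w
  ... | no _  | yes v | no ¬w = contradiction (Q⊆R v) ¬w
  ... | yes _ | no _  | yes _ = s≤s ih
  ... | no _  | yes _ | yes _ = ≤-trans (≤-reflexive (+-suc _ _)) (s≤s ih)
  ... | no _  | no _  | yes _ = m≤n⇒m≤1+n ih
  ... | no _  | no _  | no _  = ih

length-filter-yes : ∀ {a p} {A : Set a} {P : Pred A p} (P? : Decidable P) {x xs} →
                    x ∈ xs → P x → 0 < length (filter P? xs)
length-filter-yes P? {xs = xs} x∈xs px with filter P? xs | ∈-filter⁺ P? x∈xs px
... | _ ∷ _ | _ = s≤s z≤n

filter-≡⇒⊆ : ∀ {a p q} {A : Set a} {P : Pred A p} {Q : Pred A q}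
             (P? : Decidable P) (Q? : Decidable Q) {x xs} → x ∈ xs →
             filter P? xs ≡ filter Q? xs → (P x → Q x)
filter-≡⇒⊆ P? Q? {x} {xs} x∈xs eq px = proj₂ (∈-filter⁻ Q? {xs = xs} (subst (x ∈_) eq (∈-filter⁺ P? x∈xs px)))

module _ {a p} {A : Set a} {P : Pred A p} (P? : Decidable P) (f g : A → ℕ)
         (f≤g : ∀ x → f x ≤ g x) (f<g : ∀ {x} → P x → f x < g x) where

  sum-drop : ∀ xs → sum (map f xs) + length (filter P? xs) ≤ sum (map g xs)
  sum-drop []       = z≤n
  sum-drop (x ∷ xs) with P? x
  ... | yes px = begin
    f x + sum (map f xs) + suc (length (filter P? xs))    ≡⟨ +-suc _ _ ⟩
    suc (f x + sum (map f xs) + length (filter P? xs))    ≡⟨ cong suc (+-assoc (f x) _ _) ⟩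
    suc (f x) + (sum (map f xs) + length (filter P? xs))  ≤⟨ +-mono-≤ (f<g px) (sum-drop xs) ⟩
    g x + sum (map g xs)                                  ∎
    where open ≤-Reasoning
  ... | no _ = begin
    f x + sum (map f xs) + length (filter P? xs)    ≡⟨ +-assoc (f x) _ _ ⟩
    f x + (sum (map f xs) + length (filter P? xs))  ≤⟨ +-mono-≤ (f≤g x) (sum-drop xs) ⟩
    g x + sum (map g xs)                            ∎
    where open ≤-Reasoning

sum-map-≤ : ∀ {a} {A : Set a} (f : A → ℕ) {b} → (∀ x → f x ≤ b) → ∀ xs →
            sum (map f xs) ≤ length xs * b
sum-map-≤ f f≤b []       = z≤n
sum-map-≤ f f≤b (x ∷ xs) = +-mono-≤ (f≤b x) (sum-map-≤ f f≤b xs)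

log-double : ∀ {s t} → 0 < s → s + s ≤ t → ⌊log₂ s ⌋ < ⌊log₂ t ⌋
log-double {s} {t} 0<s 2s≤t = begin
  suc ⌊log₂ s ⌋    ≡⟨ ⌊log₂[2*b]⌋≡1+⌊log₂b⌋ s ⦃ >-nonZero 0<s ⦄ ⟨
  ⌊log₂ (2 * s) ⌋  ≤⟨ ⌊log₂⌋-mono-≤ (subst (_≤ t) (cong (s +_) (sym (+-identityʳ s))) 2s≤t) ⟩
  ⌊log₂ t ⌋        ∎
  where open ≤-Reasoning

heavier : (Bool → ℕ) → Bool
heavier f with f false ≤? f true
... | yes _ = true
... | no  _ = false

heavier-≥ : ∀ (f : Bool → ℕ) → f (not (heavier f)) ≤ f (heavier f)
heavier-≥ f with f false ≤? f true
... | yes f≤t = f≤t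
... | no  f≰t = ≰⇒≥ f≰t

-- Trace classes, majorities and balanced vertex sets

module Traces {m n : ℕ} (I : Fin m → Fin n → Bool) where

  SameTrace : List (Fin n) → Fin m → Fin m → Set
  SameTrace W ℓ ℓ′ = All (λ w → I ℓ w ≡ I ℓ′ w) W

  sameTrace? : ∀ W ℓ → Decidable (SameTrace W ℓ)
  sameTrace? W ℓ ℓ′ = all? (λ w → I ℓ w ≟ᵇ I ℓ′ w) W

  SameTrace-refl : ∀ W ℓ → SameTrace W ℓ ℓ
  SameTrace-refl W ℓ = All.universal (λ _ → refl) W

  SameTrace-sym : ∀ {W ℓ ℓ′} → SameTrace W ℓ ℓ′ → SameTrace W ℓ′ ℓ
  SameTrace-sym = All.map sym

  SameTrace-trans : ∀ {W ℓ ℓ′ ℓ″} → SameTrace W ℓ ℓ′ → SameTrace W ℓ′ ℓ″ → SameTrace W ℓ ℓ″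
  SameTrace-trans p q = All.zipWith (λ (u , v) → trans u v) (p , q)

  class : List (Fin n) → Fin m → List (Fin m)
  class W ℓ = filter (sameTrace? W ℓ) (allFin m)

  rep : List (Fin n) → Fin m → Fin m
  rep W ℓ = fromMaybe ℓ (head (class W ℓ))

  rep-sameTrace : ∀ W ℓ → SameTrace W ℓ (rep W ℓ)
  rep-sameTrace W ℓ with class W ℓ | (λ {ρ} → ∈-filter⁻ (sameTrace? W ℓ) {ρ} {allFin m})
  ... | []    | _    = SameTrace-refl W ℓ
  ... | _ ∷ _ | ∈⁻ = proj₂ (∈⁻ (here refl))

  -- Equivalent predicates filter `allFin m` to the same list, hence to the same head.
  rep-cong : ∀ W {ℓ ℓ′} → SameTrace W ℓ ℓ′ → rep W ℓ ≡ rep W ℓ′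
  rep-cong W {ℓ} {ℓ′} ℓ~ℓ′
    with class W ℓ | class W ℓ′ | class-≡ | ∈-filter⁺ (sameTrace? W ℓ) (∈-allFin ℓ) (SameTrace-refl W ℓ)
    where
    class-≡ : class W ℓ ≡ class W ℓ′
    class-≡ = filter-≐ (sameTrace? W ℓ) (sameTrace? W ℓ′)
      (SameTrace-trans (SameTrace-sym ℓ~ℓ′) , SameTrace-trans ℓ~ℓ′) (allFin m)
  ... | _ ∷ _ | _ | refl | _ = refl

  Side : List (Fin n) → Fin n → Fin m → Bool → Pred (Fin m) _
  Side W v ℓ b ℓ′ = SameTrace W ℓ ℓ′ × I ℓ′ v ≡ b

  side? : ∀ W v ℓ b → Decidable (Side W v ℓ b)
  side? W v ℓ b ℓ′ = sameTrace? W ℓ ℓ′ ×-dec (I ℓ′ v ≟ᵇ b)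

  sideSize : List (Fin n) → Fin n → Fin m → Bool → ℕ
  sideSize W v ℓ b = length (filter (side? W v ℓ b) (allFin m))

  majority : List (Fin n) → Fin n → Fin m → Bool
  majority W v ℓ = heavier (sideSize W v ℓ)

  -- The majority is read off at the representative, so that one bit per class suffices to decode.
  Minority : List (Fin n) → Fin n → Pred (Fin m) _
  Minority W v ℓ = I ℓ v ≢ majority W v (rep W ℓ)

  minority? : ∀ W v → Decidable (Minority W v)
  minority? W v ℓ = ¬? (I ℓ v ≟ᵇ majority W v (rep W ℓ))

  deviation : List (Fin n) → Fin n → ℕ
  deviation W v = length (filter (minority? W v) (allFin m))

  classSize : List (Fin n) → Fin m → ℕ
  classSize W ℓ = length (class W ℓ)

  0<classSize : ∀ W ℓ → 0 < classSize W ℓ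
  0<classSize W ℓ = length-filter-yes (sameTrace? W ℓ) (∈-allFin ℓ) (SameTrace-refl W ℓ)

  classSize-∷ : ∀ W v ℓ → classSize (v ∷ W) ℓ ≤ classSize W ℓ
  classSize-∷ W v ℓ = length-filter-⊆ (sameTrace? (v ∷ W) ℓ) (sameTrace? W ℓ) All.tail (allFin m)

  -- The refined class of `ℓ` lies on the lighter side of the split that `v` makes in the old class,
  -- so two copies of it fit into the two sides.
  classSize-minority : ∀ W v {ℓ} → Minority W v ℓ →
    classSize (v ∷ W) ℓ + classSize (v ∷ W) ℓ ≤ classSize W ℓ
  classSize-minority W v {ℓ} minor = begin
    classSize (v ∷ W) ℓ + classSize (v ∷ W) ℓ              ≤⟨ +-mono-≤ small (≤-trans small (heavier-≥ (sideSize W v ρ))) ⟩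
    sideSize W v ρ (not b) + sideSize W v ρ b              ≤⟨ length-filter-disjoint (side? W v ρ (not b)) (side? W v ρ b)
                                                                (sameTrace? W ℓ) back back
                                                                (λ p q → not-¬ (proj₂ q) (proj₂ p)) (allFin m) ⟩
    classSize W ℓ                                          ∎
    where
    open ≤-Reasoning
    ρ = rep W ℓ
    b = majority W v ρ
    ρ~ℓ = SameTrace-sym (rep-sameTrace W ℓ)
    back : ∀ {c ℓ′} → Side W v ρ c ℓ′ → SameTrace W ℓ ℓ′
    back (ρ~ℓ′ , _) = SameTrace-trans (rep-sameTrace W ℓ) ρ~ℓ′
    small : classSize (v ∷ W) ℓ ≤ sideSize W v ρ (not b)
    small = length-filter-⊆ (sameTrace? (v ∷ W) ℓ) (side? W v ρ (not b))
      (λ { (eq ∷ ℓ~ℓ′) → SameTrace-trans ρ~ℓ ℓ~ℓ′ , trans (sym eq) (¬-not minor) }) (allFin m)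

  potential : List (Fin n) → ℕ
  potential W = sum (map (λ ℓ → ⌊log₂ classSize W ℓ ⌋) (allFin m))

  potential-≤ : ∀ W → potential W ≤ m * ⌊log₂ m ⌋
  potential-≤ W = subst (λ k → potential W ≤ k * ⌊log₂ m ⌋) (length-tabulate {n = m} (λ i → i))
    (sum-map-≤ _ (λ ℓ → ⌊log₂⌋-mono-≤ (classSize≤m ℓ)) (allFin m))
    where
    classSize≤m : ∀ ℓ → classSize W ℓ ≤ m
    classSize≤m ℓ = subst (classSize W ℓ ≤_) (length-tabulate {n = m} (λ i → i))
      (length-filter (sameTrace? W ℓ) (allFin m))

  -- Each minority line has its class at least halved and loses one in the logarithm; no other class
  -- grows.
  potential-drop : ∀ W v → potential (v ∷ W) + deviation W v ≤ potential W
  potential-drop W v = sum-drop (minority? W v) _ _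
    (λ ℓ → ⌊log₂⌋-mono-≤ (classSize-∷ W v ℓ))
    (λ {ℓ} minor → log-double (0<classSize (v ∷ W) ℓ) (classSize-minority W v minor))
    (allFin m)

  Balanced : ℕ → List (Fin n) → Set
  Balanced d W = ∀ v → deviation W v ≤ d

  -- Greedy: while some vertex deviates on more than `d` lines, add it to `W`. Each addition is paid
  -- for by a potential drop of at least `suc d`.
  balance : ∀ d → ∃ λ W → Balanced d W × length W * suc d ≤ m * ⌊log₂ m ⌋
  balance d = go (potential []) [] ≤-refl (potential-≤ [])
    where
    go : ∀ fuel W → potential W ≤ fuel → length W * suc d + potential W ≤ m * ⌊log₂ m ⌋ →
         ∃ λ W → Balanced d W × length W * suc d ≤ m * ⌊log₂ m ⌋
    go fuel W Φ≤fuel inv with any? (λ v → suc d ≤? deviation W v)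
    ... | no none = W , (λ v → ≮⇒≥ (λ d<dev → none (v , d<dev))) , m+n≤o⇒m≤o _ inv
    -- With no fuel the potential is 0 and cannot fall by the positive deviation of `v`.
    go zero W Φ≤fuel inv | yes (v , d<dev) = contradiction
      (≤-trans d<dev (≤-trans (m+n≤o⇒n≤o _ (potential-drop W v)) Φ≤fuel)) λ ()
    go (suc fuel) W Φ≤fuel inv | yes (v , d<dev) = go fuel (v ∷ W) less more
      where
      open ≤-Reasoning
      drop : suc d + potential (v ∷ W) ≤ potential W
      drop = ≤-trans (+-monoˡ-≤ _ d<dev) (subst (_≤ potential W) (+-comm (potential (v ∷ W)) _) (potential-drop W v))
      less : potential (v ∷ W) ≤ fuel
      less = s≤s⁻¹ (≤-trans (s≤s (m≤n+m _ d)) (≤-trans drop Φ≤fuel))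
      more : suc d + length W * suc d + potential (v ∷ W) ≤ m * ⌊log₂ m ⌋
      more = begin
        suc d + length W * suc d + potential (v ∷ W)    ≡⟨ cong (_+ potential (v ∷ W)) (+-comm (suc d) _) ⟩
        length W * suc d + suc d + potential (v ∷ W)    ≡⟨ +-assoc (length W * suc d) _ _ ⟩
        length W * suc d + (suc d + potential (v ∷ W))  ≤⟨ +-monoʳ-≤ (length W * suc d) drop ⟩
        length W * suc d + potential W                  ≤⟨ inv ⟩
        m * ⌊log₂ m ⌋                                   ∎

-- Incidence axioms for lines

record LineSystem (m n : ℕ) : Set where
  field
    incident  : Fin m → Fin n → Bool
    through   : ∀ {u v} → u ≢ v → Fin m
    through-∋ : ∀ {u v} (u≢v : u ≢ v) → incident (through u≢v) u ≡ true
    -- For v ≠ w both sides say whether {u, v, w} is an edge.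
    exchange  : ∀ {u v w} (u≢v : u ≢ v) (w≢u : w ≢ u) →
                incident (through u≢v) w ≡ incident (through w≢u) v
    -- This encodes the absence of universal lines: `w` is a vertex off the line of `u` and `v`, so
    -- the three form no edge.
    separate  : ∀ {u v} → u ≢ v → ∃ λ w → Σ (u ≢ w) λ u≢w → Σ (v ≢ w) λ v≢w →
                incident (through u≢w) v ≡ false × incident (through v≢w) u ≡ false

-- Encoding vertices and pairs of vertices

module Counting {m n : ℕ} (S : LineSystem m n) where
  open LineSystem S
  open Traces incident

  star-injective : ∀ {u v} → (∀ ℓ → incident ℓ u ≡ incident ℓ v) → u ≡ v
  star-injective {u} {v} same with u ≟ᶠ v
  ... | yes u≡v = u≡v
  ... | no  u≢v = let _ , u≢w , _ , v∉uw , _ = separate u≢v in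
    contradiction (trans (sym (through-∋ u≢w)) (trans (same _) v∉uw)) true≢false

  -- A crude bound, used to make `m` large when `n` is: a vertex is determined by the lines
  -- containing it.
  n≤2^m : n ≤ 2 ^ m
  n≤2^m = injective⇒≤ {f = λ v → funToFin (λ ℓ → bit (incident ℓ v))}
    (λ eq → star-injective (λ ℓ → bit-injective (funToFin-injective _ _ eq ℓ)))

  -- The symbol `zero` is reserved for `w ≡ x`, where there is no line.
  spoke : Fin n → Fin n → Fin (suc m)
  spoke w x with w ≟ᶠ x
  ... | yes _   = zero
  ... | no w≢x = suc (through w≢x)

  spoke-≡ : ∀ {w x x′} → x ≢ x′ → spoke w x ≡ spoke w x′ →
            Σ (w ≢ x) λ w≢x → Σ (w ≢ x′) λ w≢x′ → through w≢x ≡ through w≢x′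
  spoke-≡ {w} {x} {x′} x≢x′ eq with w ≟ᶠ x | w ≟ᶠ x′
  ... | yes w≡x | yes w≡x′ = contradiction (trans (sym w≡x) w≡x′) x≢x′
  ... | no w≢x  | no w≢x′  = w≢x , w≢x′ , Fin-suc-injective eq

  spokes : (W : List (Fin n)) → Fin n → Fin (length W) → Fin (suc m)
  spokes W x i = spoke (lookupˡ W i) x

  -- By `exchange`, `w` is on the line `xz` iff `z` is on `wx`, and `wx` is the same line as `wx′`.
  sameTrace-through : ∀ {x x′ z} W → (x≢x′ : x ≢ x′) (x≢z : x ≢ z) (x′≢z : x′ ≢ z) →
    spokes W x ≗ spokes W x′ → SameTrace W (through x≢z) (through x′≢z)
  sameTrace-through []      x≢x′ x≢z x′≢z eq = []
  sameTrace-through {z = z} (w ∷ W) x≢x′ x≢z x′≢z eq with spoke-≡ x≢x′ (eq zero)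
  ... | w≢x , w≢x′ , same =
    trans (exchange x≢z w≢x) (trans (cong (λ ℓ → incident ℓ z) same) (sym (exchange x′≢z w≢x′)))
    ∷ sameTrace-through W x≢x′ x≢z x′≢z (eq ∘ suc)

  spokes-injective : ∀ W {x x′} → spokes W x ≗ spokes W x′ →
    (∀ ℓ → rep W ℓ ≢ ℓ → incident ℓ x ≡ incident ℓ x′) → x ≡ x′
  spokes-injective W {x} {x′} spokes-≡ same with x ≟ᶠ x′
  ... | yes x≡x′ = x≡x′
  ... | no  x≢x′ with separate x≢x′
  ...   | z , x≢z , x′≢z , x′∉xz , x∉x′z
        with rep W (through x≢z) ≟ᶠ through x≢z | rep W (through x′≢z) ≟ᶠ through x′≢z
  ...     | no nonrep | _ = contradiction
            (trans (sym (through-∋ x≢z)) (trans (same _ nonrep) x′∉xz)) true≢false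
  ...     | yes _ | no nonrep = contradiction
            (trans (sym (through-∋ x′≢z)) (trans (sym (same _ nonrep)) x∉x′z)) true≢false
  -- Two representatives of one class coincide, so `x′` would lie on `xz`.
  ...     | yes fixed | yes fixed′ = contradiction
            (trans (sym (through-∋ x′≢z)) (trans (cong (λ ℓ → incident ℓ x′) (sym xz≡x′z)) x′∉xz)) true≢false
    where
    xz≡x′z : through x≢z ≡ through x′≢z
    xz≡x′z = trans (sym fixed)
      (trans (rep-cong W (sameTrace-through W x≢x′ x≢z x′≢z spokes-≡)) fixed′)

  minorities : List (Fin n) → Fin n → List (Fin m)
  minorities W y = filter (minority? W y) (allFin m)

  -- The incidence of `y` with a line is the majority bit of its representative, flipped exactly on
  -- the listed lines.
  minorities-injective : ∀ W {y y′} → minorities W y ≡ minorities W y′ →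
    (∀ ℓ → rep W ℓ ≡ ℓ → majority W y ℓ ≡ majority W y′ ℓ) → y ≡ y′
  minorities-injective W {y} {y′} minor-≡ maj-≡ = star-injective same
    where
    same : ∀ ℓ → incident ℓ y ≡ incident ℓ y′
    same ℓ with minority? W y ℓ | minority? W y′ ℓ
      -- The majority hypothesis covers only fixed points of `rep W`; it applies here because
      -- `rep W` is idempotent.
      | maj-≡ (rep W ℓ) (sym (rep-cong W (rep-sameTrace W ℓ)))
    ... | yes p | yes q | eq = trans (¬-not p) (trans (cong not eq) (sym (¬-not q)))
    ... | yes p | no ¬q | _  = contradiction
      (filter-≡⇒⊆ (minority? W y) (minority? W y′) (∈-allFin ℓ) minor-≡ p) ¬q
    ... | no ¬p | yes q | _  = contradiction
      (filter-≡⇒⊆ (minority? W y′) (minority? W y) (∈-allFin ℓ) (sym minor-≡) q) ¬p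
    ... | no ¬p | no ¬q | eq = trans (decidable-stable (_ ≟ᵇ _) ¬p)
      (trans eq (sym (decidable-stable (_ ≟ᵇ _) ¬q)))

  mixed : List (Fin n) → Fin n → Fin n → Fin m → Bool
  mixed W x y ℓ = if does (rep W ℓ ≟ᶠ ℓ) then majority W y ℓ else incident ℓ x

  mixed-rep : ∀ W x y {ℓ} → rep W ℓ ≡ ℓ → mixed W x y ℓ ≡ majority W y ℓ
  mixed-rep W x y {ℓ} fixed with rep W ℓ ≟ᶠ ℓ
  ... | yes _ = refl
  ... | no ¬p = contradiction fixed ¬p

  mixed-nonrep : ∀ W x y {ℓ} → rep W ℓ ≢ ℓ → mixed W x y ℓ ≡ incident ℓ x
  mixed-nonrep W x y {ℓ} nonrep with rep W ℓ ≟ᶠ ℓ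
  ... | yes p = contradiction p nonrep
  ... | no _  = refl

  n²≤ : ∀ {d} W → Balanced d W → n * n ≤ suc m ^ length W * (suc m ^ d * 2 ^ m)
  -- `remQuot n` reads an element of `Fin (n * n)` as a pair of vertices.
  n²≤ {d} W balanced = injective⇒≤ {f = code ∘ remQuot n}
    (λ {i} {j} eq → trans (sym (combine-remQuot {n} n i))
      (trans (cong (uncurry combine) (code-injective eq)) (combine-remQuot {n} n j)))
    where
    code : Fin n × Fin n → Fin (suc m ^ length W * (suc m ^ d * 2 ^ m))
    code (x , y) = combine (funToFin (spokes W x))
      (combine (funToFin (padded (minorities W y) d)) (funToFin (bit ∘ mixed W x y)))
    -- The spokes with the shared word recover `x`; the minority list with the same word recovers
    -- `y`.
    code-injective : Injective _≡_ _≡_ code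
    code-injective {x , y} {x′ , y′} eq
      with eq₁ , eq₂₃ ← combine-injective (funToFin (spokes W x)) _ (funToFin (spokes W x′)) _ eq
      with eq₂ , eq₃ ← combine-injective (funToFin (padded (minorities W y) d)) _
                                         (funToFin (padded (minorities W y′) d)) _ eq₂₃
      = cong₂ _,_
        (spokes-injective W (funToFin-injective _ _ eq₁)
          (λ ℓ nonrep → trans (sym (mixed-nonrep W x y nonrep)) (trans (mixed-≡ ℓ) (mixed-nonrep W x′ y′ nonrep))))
        (minorities-injective W
          (padded-injective _ _ (balanced y) (balanced y′) (funToFin-injective _ _ eq₂))
          (λ ℓ fixed → trans (sym (mixed-rep W x y fixed)) (trans (mixed-≡ ℓ) (mixed-rep W x′ y′ fixed))))
      where
      mixed-≡ : ∀ ℓ → mixed W x y ℓ ≡ mixed W x′ y′ ℓ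
      mixed-≡ ℓ = bit-injective (funToFin-injective _ _ eq₃ ℓ)

-- Lines of a hypergraph as a line system

lookup-ext : ∀ {A : Set} {n} (xs ys : Vec A n) → (∀ i → lookup xs i ≡ lookup ys i) → xs ≡ ys
lookup-ext xs ys eq = trans (sym (tabulate∘lookup xs)) (trans (tabulate-cong eq) (tabulate∘lookup ys))

≟ᶠ-refl : ∀ {n} (u : Fin n) → ⌊ u ≟ᶠ u ⌋ ≡ true
≟ᶠ-refl u = trans (isYes≗does (u ≟ᶠ u)) (dec-true (u ≟ᶠ u) refl)

≟ᶠ-≢ : ∀ {n} {u v : Fin n} → u ≢ v → ⌊ u ≟ᶠ v ⌋ ≡ false
≟ᶠ-≢ {u = u} {v} u≢v = trans (isYes≗does (u ≟ᶠ v)) (dec-false (u ≟ᶠ v) u≢v)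

≟ᶠ-sym : ∀ {n} (u v : Fin n) → ⌊ u ≟ᶠ v ⌋ ≡ ⌊ v ≟ᶠ u ⌋
≟ᶠ-sym u v with u ≟ᶠ v
... | yes refl = sym (≟ᶠ-refl u)
... | no  u≢v  = sym (≟ᶠ-≢ (λ v≡u → u≢v (sym v≡u)))

module _ {n} (G : Hypergraph3 n) where

  on : Fin n → Fin n → Fin n → Bool
  on u v p = lookup (line G u v) p

  on-≡ : ∀ u v p → on u v p ≡ ⌊ p ≟ᶠ u ⌋ ∨ ⌊ p ≟ᶠ v ⌋ ∨ edge G (⁅ u ⁆ ∪ ⁅ v ⁆ ∪ ⁅ p ⁆)
  on-≡ u v p = lookup∘tabulate _ p

  on-left : ∀ u v → on u v u ≡ true
  on-left u v = trans (on-≡ u v u) (cong (λ b → b ∨ ⌊ u ≟ᶠ v ⌋ ∨ edge G (⁅ u ⁆ ∪ ⁅ v ⁆ ∪ ⁅ u ⁆)) (≟ᶠ-refl u))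

  on-comm : ∀ u v p → on u v p ≡ on v u p
  on-comm u v p = begin
    on u v p                                 ≡⟨ on-≡ u v p ⟩
    a ∨ b ∨ edge G (⁅ u ⁆ ∪ ⁅ v ⁆ ∪ ⁅ p ⁆)   ≡⟨ ∨-assoc a b _ ⟨
    (a ∨ b) ∨ edge G (⁅ u ⁆ ∪ ⁅ v ⁆ ∪ ⁅ p ⁆) ≡⟨ cong₂ (λ x e → x ∨ edge G e) (∨-comm a b) swap ⟩
    (b ∨ a) ∨ edge G (⁅ v ⁆ ∪ ⁅ u ⁆ ∪ ⁅ p ⁆) ≡⟨ ∨-assoc b a _ ⟩
    b ∨ a ∨ edge G (⁅ v ⁆ ∪ ⁅ u ⁆ ∪ ⁅ p ⁆)   ≡⟨ on-≡ v u p ⟨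
    on v u p                                 ∎
    where
    open ≡-Reasoning
    a = ⌊ p ≟ᶠ u ⌋
    b = ⌊ p ≟ᶠ v ⌋
    swap : ⁅ u ⁆ ∪ ⁅ v ⁆ ∪ ⁅ p ⁆ ≡ ⁅ v ⁆ ∪ ⁅ u ⁆ ∪ ⁅ p ⁆
    swap = trans (sym (∪-assoc ⁅ u ⁆ ⁅ v ⁆ ⁅ p ⁆))
      (trans (cong (_∪ ⁅ p ⁆) (∪-comm ⁅ u ⁆ ⁅ v ⁆)) (∪-assoc ⁅ v ⁆ ⁅ u ⁆ ⁅ p ⁆))

  on-right : ∀ u v → on u v v ≡ true
  on-right u v = trans (on-comm u v v) (on-left v u)

  -- The two inequalities make the first disjunct false on both sides; the other disjuncts are
  -- symmetric in `v` and `p`.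
  on-swap : ∀ {u v p} → v ≢ u → p ≢ u → on u v p ≡ on u p v
  on-swap {u} {v} {p} v≢u p≢u = begin
    on u v p                                                        ≡⟨ on-≡ u v p ⟩
    ⌊ p ≟ᶠ u ⌋ ∨ ⌊ p ≟ᶠ v ⌋ ∨ edge G (⁅ u ⁆ ∪ ⁅ v ⁆ ∪ ⁅ p ⁆)  ≡⟨ cong₂ _∨_ (trans (≟ᶠ-≢ p≢u) (sym (≟ᶠ-≢ v≢u)))
                                                                      (cong₂ _∨_ (≟ᶠ-sym p v)
                                                                        (cong (λ e → edge G (⁅ u ⁆ ∪ e)) (∪-comm ⁅ v ⁆ ⁅ p ⁆))) ⟩
    ⌊ v ≟ᶠ u ⌋ ∨ ⌊ v ≟ᶠ p ⌋ ∨ edge G (⁅ u ⁆ ∪ ⁅ p ⁆ ∪ ⁅ v ⁆)  ≡⟨ on-≡ u p v ⟨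
    on u p v                                                        ∎
    where open ≡-Reasoning

  lines : List (Subset n)
  lines = deduplicate (≡-dec _≟ᵇ_) (allLines G)

  line∈lines : ∀ {u v} → u ≢ v → line G u v ∈ lines
  line∈lines {u} {v} u≢v = ∈-deduplicate⁺ (≡-dec _≟ᵇ_)
    (∈-concatMap⁺ (λ u → map (line G u) (filter (λ v → ¬? (u ≟ᶠ v)) (allFin n)))
      (lose (∈-allFin u) (∈-map⁺ (line G u) (∈-filter⁺ (λ v → ¬? (u ≟ᶠ v)) (∈-allFin v) u≢v))))

  -- Lines are indexed by their positions in the deduplicated list, so equal lines get equal
  -- indices.
  lineSystem : NoUniversalLine G → LineSystem (numLines G) n
  lineSystem noUniversal = record
    { incident  = λ ℓ p → lookup (lookupˡ lines ℓ) p
    ; through   = λ u≢v → index (line∈lines u≢v)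
    ; through-∋ = λ {u} {v} u≢v → trans (incident-≡ u≢v u) (on-left u v)
    ; exchange  = λ {u} {v} {w} u≢v w≢u → trans (incident-≡ u≢v w)
        (trans (on-swap (≢-sym u≢v) w≢u) (trans (on-comm u w v) (sym (incident-≡ w≢u v))))
    ; separate  = λ {u} {v} u≢v →
        -- The vertex `w` differs from `u` and `v` because these lie on their own line.
        let w , w∉uv = missed u≢v
            u≢w = λ u≡w → true≢false (trans (sym (on-left u v)) (trans (cong (on u v) u≡w) w∉uv))
            v≢w = λ v≡w → true≢false (trans (sym (on-right u v)) (trans (cong (on u v) v≡w) w∉uv))
        in w , u≢w , v≢w
         , trans (incident-≡ u≢w v) (trans (on-swap (≢-sym u≢w) (≢-sym u≢v)) w∉uv)
         , trans (incident-≡ v≢w u) (trans (on-swap (≢-sym v≢w) u≢v) (trans (on-comm v u w) w∉uv))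
    }
    where
    incident-≡ : ∀ {u v} (u≢v : u ≢ v) p → lookup (lookupˡ lines (index (line∈lines u≢v))) p ≡ on u v p
    incident-≡ u≢v p = cong (λ L → lookup L p) (sym (lookup-index (line∈lines u≢v)))
    missed : ∀ {u v} → u ≢ v → ∃ λ w → on u v w ≡ false
    missed {u} {v} u≢v =
      let w , w∉ = ¬∀⟶∃¬ n (λ w → on u v w ≡ true) (λ w → on u v w ≟ᵇ true)
            (λ all → noUniversal u v u≢v (lookup-ext _ _ (λ w → trans (all w) (sym (lookup-replicate w true)))))
      in w , ¬-not w∉

-- Numerical estimates

n<2^n : ∀ n → n < 2 ^ n
n<2^n zero    = s≤s z≤n
n<2^n (suc n) = begin
  suc (suc n)          ≤⟨ s≤s (n<2^n n) ⟩
  suc (2 ^ n)          ≤⟨ +-monoˡ-≤ (2 ^ n) (m^n>0 2 n) ⟩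
  2 ^ n + 2 ^ n        ≡⟨ cong (2 ^ n +_) (+-identityʳ (2 ^ n)) ⟨
  2 ^ suc n            ∎
  where open ≤-Reasoning

n<2^[1+⌊log₂n⌋] : ∀ n → n < 2 ^ suc ⌊log₂ n ⌋
n<2^[1+⌊log₂n⌋] n = ≰⇒> λ 2^≤n →
  n≮n _ (subst (_≤ ⌊log₂ n ⌋) (⌊log₂[2^n]⌋≡n (suc ⌊log₂ n ⌋)) (⌊log₂⌋-mono-≤ 2^≤n))

2^⌊log₂n⌋≤n : ∀ n → 0 < n → 2 ^ ⌊log₂ n ⌋ ≤ n
2^⌊log₂n⌋≤n = <-rec _ step
  where
  step : ∀ n → (∀ {k} → k < n → 0 < k → 2 ^ ⌊log₂ k ⌋ ≤ k) → 0 < n → 2 ^ ⌊log₂ n ⌋ ≤ n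
  step 1               rec _ = ≤-refl
  step n@(suc (suc k)) rec _ = begin
    2 ^ ⌊log₂ n ⌋                ≤⟨ ^-monoʳ-≤ 2 (m≤n+m∸n ⌊log₂ n ⌋ 1) ⟩
    2 * 2 ^ (⌊log₂ n ⌋ ∸ 1)      ≡⟨ cong (λ l → 2 * 2 ^ l) (⌊log₂⌊n/2⌋⌋≡⌊log₂n⌋∸1 n) ⟨
    2 * 2 ^ ⌊log₂ ⌊ n /2⌋ ⌋      ≤⟨ *-monoʳ-≤ 2 (rec (⌊n/2⌋<n (suc k)) (s≤s z≤n)) ⟩
    2 * ⌊ n /2⌋                  ≡⟨ cong (⌊ n /2⌋ +_) (+-identityʳ _) ⟩
    ⌊ n /2⌋ + ⌊ n /2⌋            ≤⟨ +-monoʳ-≤ ⌊ n /2⌋ (⌊n/2⌋≤⌈n/2⌉ n) ⟩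
    ⌊ n /2⌋ + ⌈ n /2⌉            ≡⟨ ⌊n/2⌋+⌈n/2⌉≡n n ⟩
    n                            ∎
    where open ≤-Reasoning

^-distribʳ-* : ∀ k m n → (m * n) ^ k ≡ m ^ k * n ^ k
^-distribʳ-* zero    m n = refl
^-distribʳ-* (suc k) m n = trans (cong (m * n *_) (^-distribʳ-* k m n)) ([m*n]*[o*p]≡[m*o]*[n*p] m n (m ^ k) (n ^ k))

^-cancelʳ-≤ : ∀ k {m n} .{{_ : NonZero k}} → m ^ k ≤ n ^ k → m ≤ n
^-cancelʳ-≤ k le = ≮⇒≥ λ n<m → <⇒≱ (^-monoˡ-< k n<m) le

module _ (j : ℕ) where
  private c = suc j

  -- With t = ⌊l/c⌋ one has 1 + l ≤ c (1 + t) ≤ c 2ᵗ, hence (1 + l)ᶜ ≤ cᶜ 2ˡ.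
  power≤exponential : ∀ l → suc l ^ c ≤ c ^ c * 2 ^ l
  power≤exponential l = begin
    suc l ^ c              ≤⟨ ^-monoˡ-≤ c 1+l≤ ⟩
    (c * 2 ^ t) ^ c        ≡⟨ ^-distribʳ-* c c (2 ^ t) ⟩
    c ^ c * (2 ^ t) ^ c    ≡⟨ cong (c ^ c *_) (^-*-assoc 2 t c) ⟩
    c ^ c * 2 ^ (t * c)    ≤⟨ *-monoʳ-≤ (c ^ c) (^-monoʳ-≤ 2 (m/n*n≤m l c)) ⟩
    c ^ c * 2 ^ l          ∎
    where
    open ≤-Reasoning
    t = l / c
    1+l≤ : suc l ≤ c * 2 ^ t
    1+l≤ = begin
      suc l                ≡⟨ cong suc (m≡m%n+[m/n]*n l c) ⟩
      suc (l % c) + t * c  ≤⟨ +-monoˡ-≤ (t * c) (m%n<n l c) ⟩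
      suc t * c            ≤⟨ *-monoˡ-≤ c (n<2^n t) ⟩
      2 ^ t * c            ≡⟨ *-comm (2 ^ t) c ⟩
      c * 2 ^ t            ∎

  -- Of the `c` factors `suc l` in `power≤exponential`, one absorbs the constant `c ^ c * A`.
  polynomial≤exponential : ∀ A l → c ^ c * A ≤ suc l → A * suc l ^ j ≤ 2 ^ l
  polynomial≤exponential A l big = *-cancelˡ-≤ (c ^ c) {{m^n≢0 c c}} (begin
    c ^ c * (A * suc l ^ j)  ≡⟨ *-assoc (c ^ c) A _ ⟨
    c ^ c * A * suc l ^ j    ≤⟨ *-monoˡ-≤ (suc l ^ j) big ⟩
    suc l ^ c                ≤⟨ power≤exponential l ⟩
    c ^ c * 2 ^ l            ∎)
    where open ≤-Reasoning

number-of-steps : ∀ {m k l d T} → m < suc d * T → k * suc d ≤ m * l → k ≤ T * l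
number-of-steps {m} {k} {l} {d} {T} m< budget = *-cancelʳ-≤ k (T * l) (suc d) (begin
  k * suc d        ≤⟨ budget ⟩
  m * l            ≤⟨ *-monoˡ-≤ l (<⇒≤ m<) ⟩
  suc d * T * l    ≡⟨ *-assoc (suc d) T l ⟩
  suc d * (T * l)  ≡⟨ *-comm (suc d) _ ⟩
  T * l * suc d    ∎)
  where open ≤-Reasoning

m<[1+m/n]*n : ∀ m n .{{_ : NonZero n}} → m < suc (m / n) * n
m<[1+m/n]*n m n = begin-strict
  m                    ≡⟨ m≡m%n+[m/n]*n m n ⟩
  m % n + m / n * n    <⟨ +-monoˡ-< (m / n * n) (m%n<n m n) ⟩
  suc (m / n) * n      ∎
  where open ≤-Reasoning

-- After doubling, the `k` part is at most `16 * (q * q) * l ^ 3` and the `d` part is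
-- `d * (4 * q * l)`, so each is at most `m`.
overhead≤ : ∀ q {k m} l d → k ≤ 4 * q * l * l → 16 * (q * q) * l ^ 3 ≤ m → d * (4 * q * l) ≤ m →
            2 * q * (l * (k + d)) ≤ m
overhead≤ q {k} {m} l d k≤ m≥ d≤ = *-cancelˡ-≤ 2 (begin
  2 * (2 * q * (l * (k + d)))                    ≡⟨ solve 4 (λ q k l d → con 2 :* (con 2 :* q :* (l :* (k :+ d)))
                                                      := con 4 :* q :* l :* k :+ d :* (con 4 :* q :* l)) refl q k l d ⟩
  4 * q * l * k + d * (4 * q * l)                ≤⟨ +-mono-≤ (*-monoʳ-≤ (4 * q * l) k≤) d≤ ⟩
  4 * q * l * (4 * q * l * l) + m                ≡⟨ cong (_+ m) (solve 2 (λ q l → con 4 :* q :* l :* (con 4 :* q :* l :* l)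
                                                      := con 16 :* (q :* q) :* (l :* (l :* (l :* con 1)))) refl q l) ⟩
  16 * (q * q) * l ^ 3 + m                       ≤⟨ +-monoˡ-≤ m m≥ ⟩
  m + m                                          ≡⟨ cong (m +_) (+-identityʳ m) ⟨
  2 * m                                          ∎)
  where
  open ≤-Reasoning
  open +-*-Solver

-- Raise the square bound to the power `a`. The extra exponent `e * a` is at most `m`, which the gap
-- between `a` and `2 * q` pays for.
square-bound⇒bound : ∀ {n m e q a} → n * n ≤ 2 ^ (m + e) → suc a ≤ 2 * q → 2 * q * e ≤ m →
                     n ^ a ≤ 2 ^ (q * m)
square-bound⇒bound {n} {m} {e} {q} {a} n²≤ a<2q e≤ = ^-cancelʳ-≤ 2 (begin
  (n ^ a) ^ 2            ≡⟨ trans (^-*-assoc n a 2) (trans (cong (n ^_) (*-comm a 2)) (sym (^-*-assoc n 2 a))) ⟩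
  (n ^ 2) ^ a            ≡⟨ cong (λ x → (n * x) ^ a) (*-identityʳ n) ⟩
  (n * n) ^ a            ≤⟨ ^-monoˡ-≤ a n²≤ ⟩
  (2 ^ (m + e)) ^ a      ≡⟨ ^-*-assoc 2 (m + e) a ⟩
  2 ^ ((m + e) * a)      ≤⟨ ^-monoʳ-≤ 2 exponent≤ ⟩
  2 ^ (q * m * 2)        ≡⟨ ^-*-assoc 2 (q * m) 2 ⟨
  (2 ^ (q * m)) ^ 2      ∎)
  where
  open ≤-Reasoning
  exponent≤ : (m + e) * a ≤ q * m * 2
  exponent≤ = begin
    (m + e) * a        ≡⟨ *-distribʳ-+ a m e ⟩
    m * a + e * a      ≤⟨ +-mono-≤ (≤-reflexive (*-comm m a))
                            (≤-trans (*-monoʳ-≤ e (<⇒≤ a<2q)) (≤-trans (≤-reflexive (*-comm e (2 * q))) e≤)) ⟩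
    a * m + m          ≡⟨ +-comm (a * m) m ⟩
    suc a * m          ≤⟨ *-monoˡ-≤ m a<2q ⟩
    2 * q * m          ≡⟨ *-assoc 2 q m ⟩
    2 * (q * m)        ≡⟨ *-comm 2 (q * m) ⟩
    q * m * 2          ∎

code-count≤ : ∀ m k d → suc m ^ k * (suc m ^ d * 2 ^ m) ≤ 2 ^ (m + suc ⌊log₂ m ⌋ * (k + d))
code-count≤ m k d = begin
  suc m ^ k * (suc m ^ d * 2 ^ m)  ≡⟨ *-assoc (suc m ^ k) _ _ ⟨
  suc m ^ k * suc m ^ d * 2 ^ m    ≡⟨ cong (_* 2 ^ m) (^-distribˡ-+-* (suc m) k d) ⟨
  -- The strict bound `m < 2 ^ l` is read as `suc m ≤ 2 ^ l`.
  suc m ^ (k + d) * 2 ^ m          ≤⟨ *-monoˡ-≤ (2 ^ m) (^-monoˡ-≤ (k + d) (n<2^[1+⌊log₂n⌋] m)) ⟩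
  (2 ^ l) ^ (k + d) * 2 ^ m        ≡⟨ cong (_* 2 ^ m) (^-*-assoc 2 l (k + d)) ⟩
  2 ^ (l * (k + d)) * 2 ^ m        ≡⟨ *-comm _ (2 ^ m) ⟩
  2 ^ m * 2 ^ (l * (k + d))        ≡⟨ ^-distribˡ-+-* 2 m _ ⟨
  2 ^ (m + l * (k + d))            ∎
  where
  open ≤-Reasoning
  l = suc ⌊log₂ m ⌋

-- Choice of parameters and the asymptotic bound

square-bound : ∀ {m n} → LineSystem m n → ∀ q .{{_ : NonZero q}} →
  16 * (q * q) * suc ⌊log₂ m ⌋ ^ 3 ≤ m →
  ∃ λ e → n * n ≤ 2 ^ (m + e) × 2 * q * e ≤ m
square-bound {m} {n} S q large = from-balanced (balance d)
  where
  open Traces (LineSystem.incident S)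
  open Counting S
  l = suc ⌊log₂ m ⌋
  T = 4 * q * l
  instance
    T≢0 : NonZero T
    T≢0 = m*n≢0 (4 * q) l {{m*n≢0 4 q}}
  -- This keeps `l * d` within `m / (4 * q)` and, as `m < suc d * T`, leaves `W` with at most
  -- `T * l` vertices.
  d = m / T
  from-balanced : (∃ λ W → Balanced d W × length W * suc d ≤ m * ⌊log₂ m ⌋) →
                  ∃ λ e → n * n ≤ 2 ^ (m + e) × 2 * q * e ≤ m
  from-balanced (W , balanced , budget) = l * (k + d) , n²≤2^ , overhead≤ q l d k≤ large (m/n*n≤m m T)
    where
    k = length W
    n²≤2^ : n * n ≤ 2 ^ (m + l * (k + d))
    n²≤2^ = ≤-trans (n²≤ W balanced) (code-count≤ m k d)
    k≤ : k ≤ T * l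
    k≤ = number-of-steps {m} {k} {l} {d} {T} (m<[1+m/n]*n m T)
      (≤-trans budget (*-monoʳ-≤ m (n≤1+n ⌊log₂ m ⌋)))

-- Here ε is `p / q`: taking logarithms gives `q * m` at least `2 * q - p` times log₂ n. Rational ε
-- suffice, and for ε at least 2 the truncated exponent is 0.
theorem1 : (p q : ℕ) → 0 < p → 0 < q →
    Σ ℕ λ n₀ → ∀ (n : ℕ) → n₀ ≤ n → (G : Hypergraph3 n) → NoUniversalLine G →
    n ^ (2 * q ∸ p) ≤ 2 ^ (q * numLines G)
theorem1 p q@(suc _) 0<p 0<q = 2 ^ 2 ^ b , bound
  where
  -- The threshold of `polynomial≤exponential` for exponent 3, where `c` is 4. Since `n ≤ 2 ^ m`,
  -- the doubly exponential `n₀` forces log₂ m to reach it.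
  b = 4 ^ 4 * (16 * (q * q))
  bound : ∀ n → 2 ^ 2 ^ b ≤ n → (G : Hypergraph3 n) → NoUniversalLine G →
          n ^ (2 * q ∸ p) ≤ 2 ^ (q * numLines G)
  bound n n₀≤n G noUniversal =
    square-bound⇒bound {n} {m} {proj₁ squared} {q} (proj₁ (proj₂ squared))
      -- As `q` is a successor, `suc (2 * q ∸ 1)` computes to `2 * q`.
      (s≤s (∸-monoʳ-≤ (2 * q) 0<p)) (proj₂ (proj₂ squared))
    where
    m = numLines G
    S = lineSystem G noUniversal
    2^b≤m : 2 ^ b ≤ m
    2^b≤m = ≮⇒≥ λ m<2^b →
      <⇒≱ (^-monoʳ-< 2 (s≤s (s≤s z≤n)) m<2^b) (≤-trans n₀≤n (Counting.n≤2^m S))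
    b≤log : b ≤ ⌊log₂ m ⌋
    b≤log = subst (_≤ ⌊log₂ m ⌋) (⌊log₂[2^n]⌋≡n b) (⌊log₂⌋-mono-≤ 2^b≤m)
    large : 16 * (q * q) * suc ⌊log₂ m ⌋ ^ 3 ≤ m
    large = ≤-trans (polynomial≤exponential 3 (16 * (q * q)) ⌊log₂ m ⌋ (m≤n⇒m≤1+n b≤log))
                    (2^⌊log₂n⌋≤n m (≤-trans (m^n>0 2 b) 2^b≤m))
    squared : ∃ λ e → n * n ≤ 2 ^ (m + e) × 2 * q * e ≤ m
    squared = square-bound S q large
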